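{- A finite interval order $P=(X,\prec)$ is a unit OC interval order if and only if it has no induced subposet isomorphic to any of $\mathbf{4}+\mathbf{1}$, $D^*$, $Z$, $Y^*$, $Y^{**}$, or the duals of these posets.
   Context: Posets are strict partial orders on a finite set; a poset $Q$ is induced in $P$ if it is isomorphic to the restriction of $P$ to some subset. $P$ is an interval order if each $x$ can be assigned a closed real interval $[L(x),R(x)]$ with $x\prec y$ iff $R(x)<L(y)$. An OC interval representation assigns to each $x$ an open or closed real interval $I(x)$ so that $x\prec y$ iff every point of $I(x)$ is less than every point of $I(y)$; $P$ is a unit OC interval order if it has such a representation with all intervals of the same length (twins are allowed). The posets are given by the listed comparabilities together with their transitive consequences, all other pairs being incomparable: $\mathbf{4}+\mathbf{1}$ on $\{a,b,c,d,x\}$ with $a\prec b\prec c\prec d$; $D^*$ on $\{a,b,c,d,x,y\}$ with $a\prec b\prec d$, $a\prec c\prec d$, $y\prec c$; $Z$ on $\{a,b,c,d,x,y\}$ with $a\prec b\prec c\prec d$, $x\prec d$, $a\prec y$; $Y^*$ on $\{a,b,c,d,x,y\}$ with $a\prec d\prec b$, $a\prec d\prec c\prec y$, $x\prec y$; $Y^{**}$ on $\{a,b,c,d,x,y\}$ with $a\prec d\prec b$, $a\prec d\prec c$, $y\prec c$. The dual of a poset reverses all comparabilities.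
   Formalization: The endpoints, the common length and the points of the intervals are rational instead of real, both in the definition of interval order and in that of unit OC interval order. -}

module Defs where

open import Data.Nat using (ℕ)
open import Data.Fin using (Fin; #_)
open import Data.Product using (Σ; _×_; _,_; swap)
open import Data.List using (List; []; _∷_; _++_; map)
open import Data.List.Membership.Propositional using (_∈_)
open import Data.Bool using (Bool; true; false)
open import Data.Rational using (ℚ; _<_; _≤_; _+_; 0ℚ)
open import Function.Bundles using (_⇔_)
open import Function.Definitions using (Injective)
open import Relation.Binary.PropositionalEquality using (_≡_)

-- Small fixed posets, given by the full list of comparable pairs
-- (i , j) meaning i ≺ j (transitive consequences already included).

record SmallPoset : Set where
  constructor poset
  field
    size  : ℕ
    pairs : List (Fin size × Fin size)
open SmallPoset public

SRel : (Q : SmallPoset) → Fin (size Q) → Fin (size Q) → Set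
SRel Q i j = (i , j) ∈ pairs Q

dual : SmallPoset → SmallPoset
dual (poset k ps) = poset k (map swap ps)

-- 4+1 on a=0,b=1,c=2,d=3,x=4 : a≺b≺c≺d
P4+1 : SmallPoset
P4+1 = poset 5
  ( (# 0 , # 1) ∷ (# 0 , # 2) ∷ (# 0 , # 3)
  ∷ (# 1 , # 2) ∷ (# 1 , # 3) ∷ (# 2 , # 3) ∷ [])

-- elements a=0,b=1,c=2,d=3,x=4,y=5 in the six-element posets below

-- D* : a≺b≺d, a≺c≺d, y≺c
D* : SmallPoset
D* = poset 6
  ( (# 0 , # 1) ∷ (# 0 , # 2) ∷ (# 0 , # 3)
  ∷ (# 1 , # 3) ∷ (# 2 , # 3) ∷ (# 5 , # 2) ∷ (# 5 , # 3) ∷ [])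

-- Z : a≺b≺c≺d, x≺d, a≺y
Z : SmallPoset
Z = poset 6
  ( (# 0 , # 1) ∷ (# 0 , # 2) ∷ (# 0 , # 3)
  ∷ (# 1 , # 2) ∷ (# 1 , # 3) ∷ (# 2 , # 3)
  ∷ (# 4 , # 3) ∷ (# 0 , # 5) ∷ [])

-- Y* : a≺d≺b, a≺d≺c≺y, x≺y
Y* : SmallPoset
Y* = poset 6
  ( (# 0 , # 3) ∷ (# 0 , # 1) ∷ (# 0 , # 2) ∷ (# 0 , # 5)
  ∷ (# 3 , # 1) ∷ (# 3 , # 2) ∷ (# 3 , # 5)
  ∷ (# 2 , # 5) ∷ (# 4 , # 5) ∷ [])

-- Y** : a≺d≺b, a≺d≺c, y≺c
Y** : SmallPoset
Y** = poset 6
  ( (# 0 , # 3) ∷ (# 0 , # 1) ∷ (# 0 , # 2)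
  ∷ (# 3 , # 1) ∷ (# 3 , # 2) ∷ (# 5 , # 2) ∷ [])

forbiddenBase : List SmallPoset
forbiddenBase = P4+1 ∷ D* ∷ Z ∷ Y* ∷ Y** ∷ []

forbidden : List SmallPoset
forbidden = forbiddenBase ++ map dual forbiddenBase

-- A finite poset is a strict order _≺_ on Fin n.

InducedIn : (Q : SmallPoset) {n : ℕ} → (Fin n → Fin n → Set) → Set
InducedIn Q {n} _≺_ =
  Σ (Fin (size Q) → Fin n) λ f →
    Injective _≡_ _≡_ f × (∀ i j → (SRel Q i j ⇔ (f i ≺ f j)))

IsIntervalOrder : {n : ℕ} → (Fin n → Fin n → Set) → Set
IsIntervalOrder {n} _≺_ =
  Σ (Fin n → ℚ) λ L → Σ (Fin n → ℚ) λ R →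
    (∀ x → L x ≤ R x) × (∀ x y → ((x ≺ y) ⇔ (R x < L y)))

record OCInterval : Set where
  constructor oc
  field
    left   : ℚ
    right  : ℚ
    closed : Bool
open OCInterval public

_∈I_ : ℚ → OCInterval → Set
q ∈I oc l r true  = (l ≤ q) × (q ≤ r)
q ∈I oc l r false = (l < q) × (q < r)

Precedes : OCInterval → OCInterval → Set
Precedes I J = ∀ p q → p ∈I I → q ∈I J → p < q

IsUnitOCIntervalOrder : {n : ℕ} → (Fin n → Fin n → Set) → Set
IsUnitOCIntervalOrder {n} _≺_ =
  Σ (Fin n → OCInterval) λ I → Σ ℚ λ c →
    (0ℚ < c) × (∀ x → right (I x) ≡ left (I x) + c)
    × (∀ x y → ((x ≺ y) ⇔ Precedes (I x) (I y)))

{-# OPTIONS --safe #-}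
module Submission where

open import Defs
open import Data.Nat using (ℕ)
open import Data.Bool using (Bool; true; false)
open import Data.Empty using (⊥; ⊥-elim)
open import Data.Fin as Fin using (Fin; #_)
open import Data.Fin.Properties using (_≟_; _<?_; <-cmp; all?; any?)
open import Data.List using (List; []; _∷_; filter; allFin; cartesianProduct)
open import Data.List.Membership.Propositional using (_∈_; find; lose)
open import Data.List.Membership.Propositional.Properties
  using (∈-map⁺; ∈-map⁻; ∈-filter⁺; ∈-filter⁻; ∈-cartesianProduct⁺; ∈-cartesianProduct⁻; ∈-allFin)
import Data.List.Membership.DecPropositional as DecMembership
open import Data.List.Relation.Binary.Permutation.Propositional using (↭-sym)
open import Data.List.Relation.Binary.Permutation.Propositional.Properties using (∈-resp-↭)
open import Data.List.Relation.Unary.All as All using (All; []; _∷_)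
open import Data.List.Relation.Unary.All.Properties using (++⁻; ++⁺; map⁺; map⁻)
open import Data.List.Relation.Unary.AllPairs using (AllPairs; []; _∷_)
open import Data.List.Relation.Unary.Any as Any using (here; there)
open import Data.List.Relation.Unary.Linked.Properties using (Linked⇒AllPairs)
open import Data.List.Sort using (sort; sort-↭; sort-↗)
open import Data.Product using (∃; _×_; _,_; proj₁; proj₂; swap)
open import Data.Product.Properties using (≡-dec)
open import Data.Rational using (ℚ; _≤_; _<_; _+_; _-_; -_; 0ℚ; 1ℚ; _⊔_; _⊓_)
import Data.Rational.Properties as ℚ
open import Data.Sum using (_⊎_; inj₁; inj₂)
open import Data.Vec using ([]; _∷_; lookup)
open import Function using (_∘_; flip; id)
open import Function.Bundles using (_⇔_; mk⇔; module Equivalence)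
open import Relation.Nullary using (¬_; Dec; yes; no; contradiction; ¬?; _×-dec_; _⊎-dec_; _→-dec_)
open import Relation.Nullary.Decidable using (True; False; toWitness; toWitnessFalse; decidable-stable)
open import Relation.Binary.Bundles using (DecTotalOrder)
open import Relation.Binary.Definitions using (Decidable; tri<; tri≈; tri>)
open import Relation.Binary.Structures using (IsStrictPartialOrder)
open import Relation.Binary.PropositionalEquality as ≡ using (_≡_; refl; sym; cong; subst; subst₂)
import Algebra.Properties.Group as GroupProperties

open Equivalence using (to; from)

-- In a unit OC representation an induced 3+1, a ≺ b ≺ c with x incomparable to all
-- three, is rigid: b is open with the same endpoints as x, while a, x and c are
-- closed and consecutive ones touch. Two overlapping such configurations in a
-- forbidden poset contradict each other.
--
-- Conversely, make exactly the middles b of the 3+1's open, and identify the endpoints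
-- of b with those of x. Together with the forced contacts this prescribes the order of
-- all endpoints, and the forbidden posets are exactly what could make the prescription
-- inconsistent. A consistent total preorder of endpoints that commutes with the shift
-- from left to right endpoints is realised by placing the intervals from left to right.

-- Small posets: incomparable pairs, twins and duals

srel? : ∀ Q → Decidable (SRel Q)
srel? Q i j = (i , j) ∈? pairs Q
  where open DecMembership (≡-dec _≟_ _≟_)

-- Requiring `i Fin.< j` records each incomparable pair once. The filtered product then lists these
-- pairs lexicographically, the order in which the exclusions below supply their proofs.
Unrelated : ∀ Q → Fin (size Q) × Fin (size Q) → Set
Unrelated Q (i , j) = i Fin.< j × ¬ SRel Q i j × ¬ SRel Q j i

unrelated? : ∀ Q p → Dec (Unrelated Q p)
unrelated? Q (i , j) = i <? j ×-dec ¬? (srel? Q i j) ×-dec ¬? (srel? Q j i)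

unrelated : ∀ Q → List (Fin (size Q) × Fin (size Q))
unrelated Q = filter (unrelated? Q) (cartesianProduct (allFin _) (allFin _))

∈-unrelated : ∀ Q {i j} → Unrelated Q (i , j) → (i , j) ∈ unrelated Q
∈-unrelated Q = ∈-filter⁺ (unrelated? Q) (∈-cartesianProduct⁺ (∈-allFin _) (∈-allFin _))

Twins : ∀ Q → Fin (size Q) → Fin (size Q) → Set
Twins Q i j = ∀ k → (SRel Q i k → SRel Q j k) × (SRel Q j k → SRel Q i k)
                  × (SRel Q k i → SRel Q k j) × (SRel Q k j → SRel Q k i)

TwinFree : SmallPoset → Set
TwinFree Q = ∀ i j → Twins Q i j → i ≡ j

twinFree? : ∀ Q → Dec (TwinFree Q)
twinFree? Q = all? λ i → all? λ j →
  all? (λ k → (srel? Q i k →-dec srel? Q j k) ×-dec (srel? Q j k →-dec srel? Q i k)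
      ×-dec (srel? Q k i →-dec srel? Q k j) ×-dec (srel? Q k j →-dec srel? Q k i))
  →-dec i ≟ j

SRel-dual : ∀ Q {i j} → SRel (dual Q) i j ⇔ SRel Q j i
SRel-dual Q {i} {j} = mk⇔ forth (∈-map⁺ swap)
  where
  forth : SRel (dual Q) i j → SRel Q j i
  forth i~j with ∈-map⁻ swap i~j
  ... | _ , j~i , refl = j~i

InducedIn-dual⁺ : ∀ Q {n} (_≺_ : Fin n → Fin n → Set) → InducedIn Q (flip _≺_) → InducedIn (dual Q) _≺_
InducedIn-dual⁺ Q _ (f , inj , rel) = f , inj , λ i j →
  mk⇔ (to (rel j i) ∘ to (SRel-dual Q)) (from (SRel-dual Q) ∘ from (rel j i))

InducedIn-dual⁻ : ∀ Q {n} (_≺_ : Fin n → Fin n → Set) → InducedIn (dual Q) _≺_ → InducedIn Q (flip _≺_)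
InducedIn-dual⁻ Q _ (f , inj , rel) = f , inj , λ i j →
  mk⇔ (to (rel j i) ∘ from (SRel-dual Q)) (to (SRel-dual Q) ∘ from (rel j i))

-- Interval orders and the configurations excluded by the forbidden posets

record IntervalOrder {n} (_≺_ : Fin n → Fin n → Set) : Set where
  field
    _≺?_    : Decidable _≺_
    irrefl  : ∀ {x} → ¬ x ≺ x
    ferrers : ∀ {x y z w} → x ≺ y → ¬ z ≺ y → z ≺ w → x ≺ w

  trans : ∀ {x y z} → x ≺ y → y ≺ z → x ≺ z
  trans x≺y = ferrers x≺y irrefl

  asym : ∀ {x y} → x ≺ y → ¬ y ≺ x
  asym x≺y y≺x = irrefl (trans x≺y y≺x)

  _∥_ : Fin n → Fin n → Set
  x ∥ y = ¬ x ≺ y × ¬ y ≺ x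

  -- Asymmetry turns the two lists into an equivalence. Injectivity then comes from twin-freeness:
  -- elements of `Q` with a common image have the same relations to all others. Twin-freeness itself
  -- is checked by evaluation.
  induced : ∀ Q {_ : True (twinFree? Q)} (f : Fin (size Q) → Fin n) →
    All (λ (i , j) → f i ≺ f j) (pairs Q) → All (λ (i , j) → f i ∥ f j) (unrelated Q) →
    InducedIn Q _≺_
  induced Q {tf} f related unrel = f , injective , λ i j → mk⇔ (forth i j) (back i j)
    where
    forth : ∀ i j → SRel Q i j → f i ≺ f j
    forth i j = All.lookup related

    back : ∀ i j → f i ≺ f j → SRel Q i j
    back i j fi≺fj with srel? Q i j | srel? Q j i
    ... | yes i~j | _       = i~j
    ... | no  _   | yes j~i = contradiction fi≺fj (asym (forth j i j~i))
    ... | no  i≁j | no  j≁i with <-cmp i j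
    ...   | tri< i<j _ _  = contradiction fi≺fj (proj₁ (All.lookup unrel (∈-unrelated Q (i<j , i≁j , j≁i))))
    ...   | tri≈ _ refl _ = contradiction fi≺fj irrefl
    ...   | tri> _ _ j<i  = contradiction fi≺fj (proj₂ (All.lookup unrel (∈-unrelated Q (j<i , j≁i , i≁j))))

    injective : ∀ {i j} → f i ≡ f j → i ≡ j
    injective {i} {j} fi≡fj = toWitness tf i j λ k →
        (λ r → back j k (subst (_≺ f k) fi≡fj (forth i k r)))
      , (λ r → back i k (subst (_≺ f k) (sym fi≡fj) (forth j k r)))
      , (λ r → back k j (subst (f k ≺_) fi≡fj (forth k i r)))
      , (λ r → back k i (subst (f k ≺_) (sym fi≡fj) (forth k j r)))

flip-interval : ∀ {n} {_≺_ : Fin n → Fin n → Set} → IntervalOrder _≺_ → IntervalOrder (flip _≺_)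
flip-interval P = record
  { _≺?_ = λ x y → y ≺? x ; irrefl = irrefl ; ferrers = λ y≺x y⊀z w≺z → ferrers w≺z y⊀z y≺x }
  where open IntervalOrder P

-- Each exclusion lists only the comparabilities that pin down the order of the
-- relevant endpoints: a ≺ b puts the right end of a before the left end of b, and
-- ¬ a ≺ x puts the left end of x at or before the right end of a.
module Exclusions {n} {_≺_ : Fin n → Fin n → Set} (P : IntervalOrder _≺_)
  (free : All (λ Q → ¬ InducedIn Q _≺_) forbiddenBase) where
  open IntervalOrder P

  no-4+1 : ∀ {a b c d x} → a ≺ b → b ≺ c → c ≺ d → ¬ a ≺ x → ¬ x ≺ d → ⊥
  no-4+1 {a} {b} {c} {d} {x} a≺b b≺c c≺d a⊀x x⊀d = All.lookup free (here refl)
    (induced P4+1 (lookup (a ∷ b ∷ c ∷ d ∷ x ∷ []))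
      (a≺b ∷ a≺c ∷ trans a≺c c≺d ∷ b≺c ∷ b≺d ∷ c≺d ∷ [])
      ( (a⊀x , x⊀d ∘ flip trans (trans a≺b b≺d))
      ∷ (a⊀x ∘ trans a≺b , x⊀d ∘ flip trans b≺d)
      ∷ (a⊀x ∘ trans a≺c , x⊀d ∘ flip trans c≺d)
      ∷ (a⊀x ∘ trans (trans a≺c c≺d) , x⊀d) ∷ []))
    where
    a≺c = trans a≺b b≺c
    b≺d = trans b≺c c≺d

  -- The unlisted incomparabilities are forced: `b ≺ c` would give the chain `a`, `b`, `c`, `d`, and
  -- `a ≺ y` the chain `a`, `y`, `c`, `d`, each forming a 4+1 with `x`.
  no-D* : ∀ {a b c d x y} →
    a ≺ b → ¬ y ≺ b → y ≺ c → b ≺ d → c ≺ d → ¬ a ≺ x → ¬ x ≺ d → ⊥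
  no-D* {a} {b} {c} {d} {x} {y} a≺b y⊀b y≺c b≺d c≺d a⊀x x⊀d = All.lookup free (there (here refl))
    (induced D* (lookup (a ∷ b ∷ c ∷ d ∷ x ∷ y ∷ []))
      (a≺b ∷ a≺c ∷ a≺d ∷ b≺d ∷ c≺d ∷ y≺c ∷ trans y≺c c≺d ∷ [])
      ( (a⊀x , x⊀d ∘ flip trans a≺d)
      ∷ (a⊀y , y⊀b ∘ flip trans a≺b)
      ∷ ((λ b≺c → no-4+1 a≺b b≺c c≺d a⊀x x⊀d) , y⊀b ∘ trans y≺c)
      ∷ (a⊀x ∘ trans a≺b , x⊀d ∘ flip trans b≺d)
      ∷ (a⊀y ∘ trans a≺b , y⊀b)
      ∷ (a⊀x ∘ trans a≺c , x⊀d ∘ flip trans c≺d)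
      ∷ (a⊀x ∘ trans a≺d , x⊀d)
      ∷ (x⊀d ∘ flip trans (trans y≺c c≺d) , a⊀x ∘ ferrers a≺b y⊀b) ∷ []))
    where
    a≺c = ferrers a≺b y⊀b y≺c
    a≺d = trans a≺b b≺d
    a⊀y : ¬ a ≺ y
    a⊀y a≺y = no-4+1 a≺y y≺c c≺d a⊀x x⊀d

  no-Z : ∀ {a b c d x y} →
    a ≺ b → b ≺ c → c ≺ d → ¬ a ≺ x → ¬ x ≺ c → ¬ b ≺ y → ¬ y ≺ d → ⊥
  no-Z {a} {b} {c} {d} {x} {y} a≺b b≺c c≺d a⊀x x⊀c b⊀y y⊀d =
    All.lookup free (there (there (here refl)))
    (induced Z (lookup (a ∷ b ∷ c ∷ d ∷ x ∷ y ∷ []))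
      (a≺b ∷ trans a≺b b≺c ∷ trans a≺b b≺d ∷ b≺c ∷ b≺d ∷ c≺d ∷ x≺d ∷ a≺y ∷ [])
      ( (a⊀x , x⊀c ∘ flip trans (trans a≺b b≺c))
      ∷ (a⊀x ∘ trans a≺b , x⊀c ∘ flip trans b≺c)
      ∷ (b⊀y , y⊀d ∘ flip trans b≺d)
      ∷ (a⊀x ∘ trans (trans a≺b b≺c) , x⊀c)
      ∷ (b⊀y ∘ trans b≺c , y⊀d ∘ flip trans c≺d)
      ∷ (b⊀y ∘ trans b≺d , y⊀d)
      ∷ (b⊀y ∘ ferrers b≺c x⊀c , a⊀x ∘ trans a≺y) ∷ []))
    where
    b≺d = trans b≺c c≺d
    a≺y : a ≺ y
    a≺y = decidable-stable (a ≺? y) λ a⊀y → no-4+1 a≺b b≺c c≺d a⊀y y⊀d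
    x≺d : x ≺ d
    x≺d = decidable-stable (x ≺? d) λ x⊀d → no-4+1 a≺b b≺c c≺d a⊀x x⊀d

  no-Y* : ∀ {a b c d x y} →
    a ≺ d → d ≺ b → d ≺ c → c ≺ y → ¬ b ≺ y → ¬ a ≺ x → ¬ x ≺ b → ¬ x ≺ c → ⊥
  no-Y* {a} {b} {c} {d} {x} {y} a≺d d≺b d≺c c≺y b⊀y a⊀x x⊀b x⊀c =
    All.lookup free (there (there (there (here refl))))
    (induced Y* (lookup (a ∷ b ∷ c ∷ d ∷ x ∷ y ∷ []))
      (a≺d ∷ a≺b ∷ a≺c ∷ trans a≺c c≺y ∷ d≺b ∷ d≺c ∷ trans d≺c c≺y ∷ c≺y ∷ x≺y ∷ [])
      ( (a⊀x , x⊀c ∘ flip trans a≺c)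
      ∷ (b⊀y ∘ flip trans c≺y , c⊀b)
      ∷ (a⊀x ∘ trans a≺b , x⊀b)
      ∷ (b⊀y , c⊀b ∘ trans c≺y)
      ∷ (a⊀x ∘ trans a≺c , x⊀c)
      ∷ (a⊀x ∘ trans a≺d , x⊀c ∘ flip trans d≺c) ∷ []))
    where
    a≺b = trans a≺d d≺b
    a≺c = trans a≺d d≺c
    c⊀b : ¬ c ≺ b
    c⊀b c≺b = no-4+1 a≺d d≺c c≺b a⊀x x⊀b
    x≺y : x ≺ y
    x≺y = decidable-stable (x ≺? y) λ x⊀y → no-4+1 a≺d d≺c c≺y a⊀x x⊀y

-- The condition is self-dual, so each consequence can also be used in the reversed order.
record ForbiddenFree {n} (_≺_ : Fin n → Fin n → Set) : Set where
  field
    order  : IntervalOrder _≺_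
    free   : All (λ Q → ¬ InducedIn Q _≺_) forbiddenBase
    cofree : All (λ Q → ¬ InducedIn Q (flip _≺_)) forbiddenBase

flip-free : ∀ {n} {_≺_ : Fin n → Fin n → Set} → ForbiddenFree _≺_ → ForbiddenFree (flip _≺_)
flip-free F = record { order = flip-interval order ; free = cofree ; cofree = free }
  where open ForbiddenFree F

module Y**-Exclusion {n} {_≺_ : Fin n → Fin n → Set} (F : ForbiddenFree _≺_) where
  open ForbiddenFree F
  open IntervalOrder order
  open Exclusions order free
  private module Co = Exclusions (flip-interval order) cofree

  -- Here the dual of `D*` enters: if `a ≺ y`, then `y` and `d` both lie between `a` and `c`,
  -- alongside `x`, and `b` tells them apart.
  no-Y** : ∀ {a b c d x y} → a ≺ d → d ≺ b → y ≺ c → ¬ y ≺ b → ¬ a ≺ x → ¬ x ≺ c → ⊥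
  no-Y** {a} {b} {c} {d} {x} {y} a≺d d≺b y≺c y⊀b a⊀x x⊀c =
    All.lookup free (there (there (there (there (here refl)))))
    (induced Y** (lookup (a ∷ b ∷ c ∷ d ∷ x ∷ y ∷ []))
      (a≺d ∷ a≺b ∷ a≺c ∷ d≺b ∷ d≺c ∷ y≺c ∷ [])
      ( (a⊀x , x⊀c ∘ flip trans a≺c)
      ∷ (a⊀y , y⊀b ∘ flip trans a≺b)
      ∷ ((λ b≺c → no-4+1 a≺d d≺b b≺c a⊀x x⊀c) , y⊀b ∘ trans y≺c)
      ∷ (a⊀x ∘ trans a≺b , λ x≺b → x⊀c (ferrers x≺b y⊀b y≺c))
      ∷ (a⊀y ∘ trans a≺b , y⊀b)
      ∷ (a⊀x ∘ trans a≺c , x⊀c)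
      ∷ (a⊀x ∘ trans a≺d , x⊀c ∘ flip trans d≺c)
      ∷ (a⊀y ∘ trans a≺d , y⊀b ∘ flip trans d≺b)
      ∷ (x⊀c ∘ flip trans y≺c , a⊀x ∘ ferrers a≺b y⊀b) ∷ []))
    where
    a≺b = trans a≺d d≺b
    d≺c = ferrers d≺b y⊀b y≺c
    a≺c = trans a≺d d≺c
    a⊀y : ¬ a ≺ y
    a⊀y a≺y = Co.no-D* y≺c y⊀b d≺b a≺y a≺d x⊀c a⊀x

-- Middles, their containers and the comparison of endpoints

-- The middle b of a 3+1 a ≺ b ≺ c, x. In a unit OC representation b and x share
-- their endpoints, b being open and x closed.
_⊏[_]_ : ∀ {n} → Fin n → (Fin n → Fin n → Set) → Fin n → Set
b ⊏[ _≺_ ] x = ∃ λ a → ∃ λ c → a ≺ b × b ≺ c × ¬ a ≺ x × ¬ x ≺ c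

-- Weak order of the left endpoints of closed elements.
_≼[_]_ : ∀ {n} → Fin n → (Fin n → Fin n → Set) → Fin n → Set
x ≼[ _≺_ ] y = (∀ {z} → z ≺ x → z ≺ y) × (∀ {z} → y ≺ z → x ≺ z)

-- For closed x and y: the right endpoint of x is at or before the left endpoint of y.
_⊴[_]_ : ∀ {n} → Fin n → (Fin n → Fin n → Set) → Fin n → Set
x ⊴[ _≺_ ] y = x ≺ y ⊎ (∃ λ u → u ⊏[ _≺_ ] x × u ≺ y) ⊎ (∃ λ v → v ⊏[ _≺_ ] y × x ≺ v)

module Middles {n} {_≺_ : Fin n → Fin n → Set} (F : ForbiddenFree _≺_) where
  open ForbiddenFree F
  open IntervalOrder order public
  open Exclusions order free
  open Y**-Exclusion F
  private
    module Co where
      open Exclusions (flip-interval order) cofree public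
      open Y**-Exclusion (flip-free F) public

  infix 4 _⊏_ _≼_ _⊴_
  _⊏_ _≼_ _⊴_ : Fin n → Fin n → Set
  b ⊏ x = b ⊏[ _≺_ ] x
  x ≼ y = x ≼[ _≺_ ] y
  x ⊴ y = x ⊴[ _≺_ ] y

  ⊏-pred : ∀ {b x z} → b ⊏ x → z ≺ x → z ≺ b
  ⊏-pred (_ , _ , a≺b , _ , a⊀x , _) z≺x = ferrers z≺x a⊀x a≺b

  ⊏-succ : ∀ {b x z} → b ⊏ x → x ≺ z → b ≺ z
  ⊏-succ (_ , _ , _ , b≺c , _ , x⊀c) x≺z = ferrers b≺c x⊀c x≺z

  -- If `x` were a middle of `w`, then `b` would be one too, with the same outer elements `a′` and
  -- `c′`; but `a` precedes `b` and not `x`, which is a `D*`. Hence no element is asked to be both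
  -- open and closed.
  container-not-middle : ∀ {b x w} → b ⊏ x → ¬ x ⊏ w
  container-not-middle b⊏x@(a , c , a≺b , b≺c , a⊀x , x⊀c) (a′ , c′ , a′≺x , x≺c′ , a′⊀w , w⊀c′) =
    no-D* a′≺x a⊀x a≺b x≺c′ (⊏-succ b⊏x x≺c′) a′⊀w w⊀c′

  middles-pred : ∀ {b b′ x z} → b ⊏ x → b′ ⊏ x → z ≺ b → z ≺ b′
  middles-pred {b} {b′} {x} {z} (a , c , a≺b , b≺c , a⊀x , x⊀c) (a′ , c′ , a′≺b′ , b′≺c′ , a′⊀x , x⊀c′) z≺b =
    decidable-stable (z ≺? b′) λ z⊀b′ → cases z⊀b′ (b′ ≺? c)
    where
    -- A `D*` needs one element above both middles that does not follow `x`. Either `c` serves, or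
    -- `b′` ends no earlier than `c` starts, and then `c′` follows `b` as well.
    cases : ¬ z ≺ b′ → Dec (b′ ≺ c) → ⊥
    cases z⊀b′ (yes b′≺c) = no-D* a′≺b′ z⊀b′ z≺b b′≺c b≺c a′⊀x x⊀c
    cases z⊀b′ (no b′⊀c)  = no-D* a′≺b′ z⊀b′ z≺b b′≺c′ (ferrers b≺c b′⊀c b′≺c′) a′⊀x x⊀c′

  -- All containers of `b` should share its endpoints; a predecessor telling two of them apart
  -- completes a dual of `Y**`.
  containers-pred : ∀ {b x x′ z} → b ⊏ x → b ⊏ x′ → z ≺ x′ → z ≺ x
  containers-pred {x = x} {z = z} (a , c , a≺b , b≺c , a⊀x , x⊀c) (a′ , c′ , a′≺b , b≺c′ , a′⊀x′ , x′⊀c′) z≺x′ =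
    decidable-stable (z ≺? x) λ z⊀x → Co.no-Y** b≺c a′≺b z≺x′ a′⊀x′ x⊀c z⊀x

  pred-or : ∀ x y → (∃ λ z → z ≺ x × ¬ z ≺ y) ⊎ (∀ {z} → z ≺ x → z ≺ y)
  pred-or x y with any? (λ z → z ≺? x ×-dec ¬? (z ≺? y))
  ... | yes w = inj₁ w
  ... | no ¬w = inj₂ λ {z} z≺x → decidable-stable (z ≺? y) λ z⊀y → ¬w (z , z≺x , z⊀y)

  succ-or : ∀ x y → (∃ λ z → y ≺ z × ¬ x ≺ z) ⊎ (∀ {z} → y ≺ z → x ≺ z)
  succ-or x y with any? (λ z → y ≺? z ×-dec ¬? (x ≺? z))
  ... | yes w = inj₁ w
  ... | no ¬w = inj₂ λ {z} y≺z → decidable-stable (x ≺? z) λ x⊀z → ¬w (z , y≺z , x⊀z)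

  _≼?_ : Decidable _≼_
  x ≼? y with pred-or x y | succ-or x y
  ... | inj₁ (_ , z≺x , z⊀y) | _                     = no λ x≼y → z⊀y (proj₁ x≼y z≺x)
  ... | inj₂ _               | inj₁ (_ , y≺z , x⊀z) = no λ x≼y → x⊀z (proj₂ x≼y y≺z)
  ... | inj₂ p               | inj₂ s                = yes (p , s)

  ≼-trans : ∀ {x y z} → x ≼ y → y ≼ z → x ≼ z
  ≼-trans (p , s) (p′ , s′) = p′ ∘ p , s ∘ s′

  -- By `ferrers`, predecessor sets are nested, and so are successor sets. If the two nestings
  -- disagree, one of `x` and `y` sits strictly inside the other and is its middle, contrary to the
  -- hypotheses.
  ⋠⇒≼ : ∀ {x y} → (∀ {w} → ¬ x ⊏ w) → (∀ {w} → ¬ y ⊏ w) → ¬ x ≼ y → y ≼ x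
  ⋠⇒≼ {x} {y} x-outer y-outer x⋠y with pred-or x y | succ-or x y | pred-or y x | succ-or y x
  ... | inj₂ p | inj₂ s | _ | _ = ⊥-elim (x⋠y (p , s))
  ... | _ | _ | inj₂ p | inj₂ s = p , s
  ... | inj₁ (z , z≺x , z⊀y) | _ | inj₁ (w , w≺y , w⊀x) | _ = contradiction (ferrers w≺y z⊀y z≺x) w⊀x
  ... | inj₁ (z , z≺x , z⊀y) | _ | _ | inj₁ (c , x≺c , y⊀c) = contradiction (z , c , z≺x , x≺c , z⊀y , y⊀c) x-outer
  ... | _ | inj₁ (z , y≺z , x⊀z) | inj₁ (w , w≺y , w⊀x) | _ = contradiction (w , z , w≺y , y≺z , w⊀x , x⊀z) y-outer
  ... | _ | inj₁ (z , y≺z , x⊀z) | _ | inj₁ (c , x≺c , y⊀c) = contradiction (ferrers y≺z x⊀z x≺c) y⊀c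

  ⊏-≼ : ∀ {u x x′} → x ≼ x′ → x′ ≼ x → u ⊏ x → u ⊏ x′
  ⊏-≼ x≼x′ x′≼x (a , c , a≺u , u≺c , a⊀x , x⊀c) =
    a , c , a≺u , u≺c , a⊀x ∘ proj₁ x′≼x , x⊀c ∘ proj₂ x≼x′

  -- Moving strictly left from a contact must give a genuine comparability. Otherwise an element
  -- telling `s` from `x` yields a `Y**`, a `D*` or a dual of `Y*`, or else a second container of a
  -- middle, against `containers-pred`.
  ⊴-strictˡ : ∀ {s x y} → s ≼ x → ¬ x ≼ s → x ⊴ y → s ≺ y
  ⊴-strictˡ s≼x _ (inj₁ x≺y) = proj₂ s≼x x≺y
  ⊴-strictˡ {s} {x} {y} s≼x x⋠s (inj₂ (inj₁ (u , u⊏x@(a , c , a≺u , u≺c , a⊀x , x⊀c) , u≺y))) =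
    decidable-stable (s ≺? y) impossible
    where
    later-end : ¬ s ≺ y → ∀ {z} → s ≺ z → ¬ x ≺ z → ⊥
    later-end s⊀y s≺z x⊀z = no-Y** a≺u u≺y s≺z s⊀y a⊀x x⊀z

    impossible : ¬ s ≺ y → ⊥
    impossible s⊀y with pred-or x s | succ-or x s
    ... | inj₂ p | inj₂ r = x⋠s (p , r)
    ... | _ | inj₁ (z , s≺z , x⊀z) = later-end s⊀y s≺z x⊀z
    ... | inj₁ (z , z≺x , z⊀s) | inj₂ _ with s ≺? c
    ...   | yes s≺c = later-end s⊀y s≺c x⊀c
    -- Now `s` contains `u` just as `x` does, so both have the same predecessors and `z` cannot
    -- separate them.
    ...   | no  s⊀c = z⊀s (containers-pred (z , c , ⊏-pred u⊏x z≺x , u≺c , z⊀s , s⊀c) u⊏x z≺x)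
  ⊴-strictˡ {s} {x} {y} s≼x x⋠s (inj₂ (inj₂ (v , v⊏y@(a , c , a≺v , v≺c , a⊀y , y⊀c) , x≺v))) =
    decidable-stable (s ≺? y) impossible
    where
    impossible : ¬ s ≺ y → ⊥
    impossible s⊀y with pred-or x s | succ-or x s
    ... | inj₂ p | inj₂ r = x⋠s (p , r)
    ... | inj₁ (z , z≺x , z⊀s) | _ =
      Co.no-Y* v≺c (proj₂ s≼x x≺v) x≺v z≺x z⊀s y⊀c s⊀y (s⊀y ∘ proj₂ s≼x)
    ... | _ | inj₁ (w , s≺w , x⊀w) with w ≺? c
    ...   | yes w≺c = no-D* s≺w x⊀w x≺v w≺c v≺c s⊀y y⊀c
    ...   | no  w⊀c = s⊀y (containers-pred v⊏y (x , c , x≺v , v≺c , x⊀w , w⊀c) s≺w)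

  ⊴-monoˡ : ∀ {s x y} → s ≼ x → x ⊴ y → s ⊴ y
  ⊴-monoˡ {s} {x} s≼x x⊴y with x ≼? s
  ... | no  x⋠s = inj₁ (⊴-strictˡ s≼x x⋠s x⊴y)
  ... | yes x≼s = transfer x⊴y
    where
    transfer : ∀ {y} → x ⊴ y → s ⊴ y
    transfer (inj₁ x≺y)                    = inj₁ (proj₂ s≼x x≺y)
    transfer (inj₂ (inj₁ (u , u⊏x , u≺y))) = inj₂ (inj₁ (u , ⊏-≼ x≼s s≼x u⊏x , u≺y))
    transfer (inj₂ (inj₂ (v , v⊏y , x≺v))) = inj₂ (inj₂ (v , v⊏y , proj₂ s≼x x≺v))

  ⊴-irrefl : ∀ {x} → ¬ x ⊴ x
  ⊴-irrefl (inj₁ x≺x) = irrefl x≺x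
  ⊴-irrefl (inj₂ (inj₁ (_ , (_ , _ , a≺u , _ , a⊀x , _) , u≺x))) = a⊀x (trans a≺u u≺x)
  ⊴-irrefl (inj₂ (inj₂ (_ , (_ , _ , _ , v≺c , _ , x⊀c) , x≺v))) = x⊀c (trans x≺v v≺c)

  touchʳ : ∀ {u x v y} → u ⊏ x → u ≺ y → v ⊏ y → x ≺ v
  touchʳ {x = x} {v} (_ , _ , a≺u , _ , a⊀x , _) u≺y (_ , _ , d≺v , _ , d⊀y , _) =
    decidable-stable (x ≺? v) λ x⊀v → no-Y** a≺u u≺y d≺v d⊀y a⊀x x⊀v

  -- If both alternatives fail, `u ≺ v` extends to a `Z`. This is why `_⊴[_]_` has clauses with one
  -- middle but none with two.
  middles-touch : ∀ {u x v y} → u ⊏ x → v ⊏ y → u ≺ v → x ≺ v ⊎ u ≺ y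
  middles-touch {u} {x} {v} {y} (_ , _ , a≺u , _ , a⊀x , _) (_ , _ , _ , v≺e , _ , y⊀e) u≺v
    with x ≺? v | u ≺? y
  ... | yes x≺v | _       = inj₁ x≺v
  ... | no  _   | yes u≺y = inj₂ u≺y
  ... | no  x⊀v | no  u⊀y = ⊥-elim (no-Z a≺u u≺v v≺e a⊀x x⊀v u⊀y y⊀e)

-- Inserting a point into a finite set of rationals

p<p+q : ∀ {p q} → 0ℚ < q → p < p + q
p<p+q {p} {q} 0<q = subst (_< p + q) (ℚ.+-identityʳ p) (ℚ.+-monoʳ-< p 0<q)

p<p+1 : ∀ p → p < p + 1ℚ
p<p+1 _ = p<p+q (ℚ.positive⁻¹ 1ℚ)

module Gaps {A : Set} (pos : A → ℚ) where

  below : ∀ highs → ∃ λ q → All (λ h → q < pos h) highs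
  below [] = 0ℚ , []
  below (h ∷ hs) with below hs
  ... | q , q<hs with q ℚ.<? pos h
  ...   | yes q<h = q , q<h ∷ q<hs
  ...   | no  q≮h = pos h - 1ℚ , h-1<h ∷ All.map (ℚ.<-trans (ℚ.<-≤-trans h-1<h (ℚ.≮⇒≥ q≮h))) q<hs
    where
    h-1<h : pos h - 1ℚ < pos h
    h-1<h = subst (pos h - 1ℚ <_) (ℚ.+-identityʳ _) (ℚ.+-monoʳ-< (pos h) (ℚ.negative⁻¹ _))

  just-above : ∀ l highs → All (λ h → l < pos h) highs → ∃ λ q → l < q × All (λ h → q < pos h) highs
  just-above l [] [] = l + 1ℚ , p<p+1 l , []
  just-above l (h ∷ hs) (l<h ∷ l<hs) with just-above l hs l<hs
  ... | q , l<q , q<hs with q ℚ.<? pos h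
  ...   | yes q<h = q , l<q , q<h ∷ q<hs
  ...   | no  q≮h with ℚ.<-dense l<h
  ...     | m , l<m , m<h = m , l<m , m<h ∷ All.map (ℚ.<-trans (ℚ.<-≤-trans m<h (ℚ.≮⇒≥ q≮h))) q<hs

  -- Only density and unboundedness are used. The candidate moves only when some `l` is not below
  -- it, and then it moves to the right, so the lower bounds already met survive.
  between : ∀ lows highs → All (λ l → All (λ h → pos l < pos h) highs) lows →
    ∃ λ q → All (λ l → pos l < q) lows × All (λ h → q < pos h) highs
  between [] highs [] with below highs
  ... | q , q<highs = q , [] , q<highs
  between (l ∷ ls) highs (l<highs ∷ ls<highs) with between ls highs ls<highs
  ... | q , ls<q , q<highs with pos l ℚ.<? q
  ...   | yes l<q = q , l<q ∷ ls<q , q<highs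
  ...   | no  l≮q with just-above (pos l) highs l<highs
  ...     | q′ , l<q′ , q′<highs =
              q′ , l<q′ ∷ All.map (λ k<q → ℚ.<-trans k<q (ℚ.≤-<-trans (ℚ.≮⇒≥ l≮q) l<q′)) ls<q , q′<highs

-- Required of both `(p , r)` and `(r , p)`, for decidable `_⊑_`, this makes `s ≤ t` equivalent to
-- `p ⊑ r`.
Agrees : {A : Set} (_⊑_ : A → A → Set) → A → A → ℚ → ℚ → Set
Agrees _⊑_ p r s t = (p ⊑ r → s ≤ t) × (¬ r ⊑ p → s < t)

module Extension {A : Set} {_⊑_ : A → A → Set} (_⊑?_ : Decidable _⊑_)
  (⊑-trans : ∀ {p r s} → p ⊑ r → r ⊑ s → p ⊑ s) (⊑-total : ∀ {p r} → ¬ p ⊑ r → r ⊑ p) where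

  -- A point tied with a listed one takes over its position; any other point falls strictly into the
  -- gap between the listed points below it and those above.
  extend : ∀ (pos : A → ℚ) ps → (∀ {r s} → r ∈ ps → s ∈ ps → Agrees _⊑_ r s (pos r) (pos s)) →
    ∀ p → ∃ λ q → ∀ {r} → r ∈ ps → Agrees _⊑_ r p (pos r) q × Agrees _⊑_ p r q (pos r)
  extend pos ps agree p with Any.any? (λ r → (r ⊑? p) ×-dec (p ⊑? r)) ps
  ... | yes tie with find tie
  ... | t , t∈ps , t⊑p , p⊑t = pos t , λ r∈ps →
      ( (λ r⊑p → proj₁ (agree r∈ps t∈ps) (⊑-trans r⊑p p⊑t))
      , (λ p⋢r → proj₂ (agree r∈ps t∈ps) (p⋢r ∘ ⊑-trans p⊑t)))
    , ( (λ p⊑r → proj₁ (agree t∈ps r∈ps) (⊑-trans t⊑p p⊑r))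
      , (λ r⋢p → proj₂ (agree t∈ps r∈ps) (λ r⊑t → r⋢p (⊑-trans r⊑t t⊑p))))
  extend pos ps agree p | no no-tie with Gaps.between pos lows highs separated
    where
    lows  = filter (_⊑? p) ps
    highs = filter (λ r → ¬? (r ⊑? p)) ps
    separated : All (λ l → All (λ h → pos l < pos h) highs) lows
    separated = All.tabulate λ l∈ → All.tabulate λ h∈ →
      let l∈ps , l⊑p = ∈-filter⁻ (_⊑? p) l∈
          h∈ps , h⋢p = ∈-filter⁻ (λ r → ¬? (r ⊑? p)) {xs = ps} h∈
      in proj₂ (agree l∈ps h∈ps) λ h⊑l → h⋢p (⊑-trans h⊑l l⊑p)
  ... | q , lows<q , q<highs = q , λ {r} r∈ps →
      ( (λ r⊑p → ℚ.<⇒≤ (low r∈ps r⊑p)) , (λ p⋢r → low r∈ps (⊑-total p⋢r)))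
    , ( (λ p⊑r → ℚ.<⇒≤ (high r∈ps λ r⊑p → no-tie (lose r∈ps (r⊑p , p⊑r)))) , high r∈ps)
    where
    low : ∀ {r} → r ∈ ps → r ⊑ p → pos r < q
    low r∈ps r⊑p = All.lookup lows<q (∈-filter⁺ (_⊑? p) r∈ps r⊑p)
    high : ∀ {r} → r ∈ ps → ¬ r ⊑ p → q < pos r
    high r∈ps r⋢p = All.lookup q<highs (∈-filter⁺ (λ r → ¬? (r ⊑? p)) r∈ps r⋢p)

-- Realising an endpoint order by unit intervals

point : {A : Set} → (A → ℚ) → A × Bool → ℚ
point L (x , false) = L x
point L (x , true)  = L x + 1ℚ

-- A finite system of unit intervals is determined up to realisation by the order
-- type of its endpoints (x , false) and (x , true). Intervals are placed from left
-- to right, so a new right endpoint never interferes with the old endpoints.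
module Placement {n} {_⊑_ : Fin n × Bool → Fin n × Bool → Set} (_⊑?_ : Decidable _⊑_)
  (⊑-trans : ∀ {p r s} → p ⊑ r → r ⊑ s → p ⊑ s) (⊑-total : ∀ {p r} → ¬ p ⊑ r → r ⊑ p)
  (shift : ∀ {x y} → (x , false) ⊑ (y , false) → (x , true) ⊑ (y , true))
  (unshift : ∀ {x y} → (x , true) ⊑ (y , true) → (x , false) ⊑ (y , false))
  (proper : ∀ {x} → ¬ (x , true) ⊑ (x , false)) where
  ⊑-refl : ∀ {p} → p ⊑ p
  ⊑-refl {p} with p ⊑? p
  ... | yes p⊑p = p⊑p
  ... | no  p⋢p = ⊑-total p⋢p

  Faithful : (Fin n → ℚ) → List (Fin n) → Set
  Faithful L xs = ∀ {x y} → x ∈ xs → y ∈ xs → ∀ b b′ →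
    Agrees _⊑_ (x , b) (y , b′) (point L (x , b)) (point L (y , b′))

  -- The recursion of `place` handles the tail first, so a descending list is placed from the left.
  Descending : List (Fin n) → Set
  Descending = AllPairs λ x y → (y , false) ⊑ (x , false)

  place : ∀ xs → Descending xs → ∃ λ L → Faithful L xs
  place [] [] = (λ _ → 0ℚ) , λ ()
  place (x ∷ xs) (xs≤x ∷ desc) with place xs desc
  ... | L , faithful with x ∈? xs
    where open DecMembership (_≟_ {n})
  -- Repetitions in the list are harmless: an element already placed keeps its position.
  ... | yes x∈xs = L , λ y∈ z∈ → faithful (old y∈) (old z∈)
    where
    old : ∀ {y} → y ∈ x ∷ xs → y ∈ xs
    old (here refl)  = x∈xs
    old (there y∈xs) = y∈xs
  ... | no  x∉xs = L′ , faithful′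
    where
    ends : List (Fin n × Bool)
    ends = cartesianProduct xs (false ∷ true ∷ [])

    ∈-ends : ∀ {y} → y ∈ xs → ∀ b → (y , b) ∈ ends
    ∈-ends y∈xs false = ∈-cartesianProduct⁺ y∈xs (here refl)
    ∈-ends y∈xs true  = ∈-cartesianProduct⁺ y∈xs (there (here refl))

    placed : ∃ λ q → ∀ {r} → r ∈ ends →
      Agrees _⊑_ r (x , false) (point L r) q × Agrees _⊑_ (x , false) r q (point L r)
    placed = Extension.extend _⊑?_ (λ {p} → ⊑-trans {p}) (λ {p} → ⊑-total {p}) (point L) ends
      (λ {r} {s} r∈ s∈ → faithful (proj₁ (∈-cartesianProduct⁻ xs _ r∈)) (proj₁ (∈-cartesianProduct⁻ xs _ s∈))
        (proj₂ r) (proj₂ s))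
      (x , false)

    q = proj₁ placed

    L′ : Fin n → ℚ
    L′ y with y ≟ x
    ... | yes _ = q
    ... | no  _ = L y

    L′-new : L′ x ≡ q
    L′-new with x ≟ x
    ... | yes _   = refl
    ... | no  x≢x = contradiction refl x≢x

    L′-old : ∀ {y} → y ∈ xs → L′ y ≡ L y
    L′-old {y} y∈xs with y ≟ x
    ... | yes refl = contradiction y∈xs x∉xs
    ... | no  _    = refl

    old-new : ∀ {y} → y ∈ xs → ∀ b b′ → Agrees _⊑_ (y , b) (x , b′) (point L (y , b)) (point (λ _ → q) (x , b′))
    old-new y∈xs b false = proj₁ (proj₂ placed (∈-ends y∈xs b))
    -- Right endpoints are compared by moving both back by the common length.
    old-new y∈xs true true =
      let ≤-case , <-case = proj₁ (proj₂ placed (∈-ends y∈xs false))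
      in (λ r → ℚ.+-monoˡ-≤ 1ℚ (≤-case (unshift r))) , (λ r → ℚ.+-monoˡ-< 1ℚ (<-case (r ∘ shift)))
    old-new {y} y∈xs false true = (λ _ → ℚ.<⇒≤ y<x+1) , (λ _ → y<x+1)
      where
      y<x+1 : L y < q + 1ℚ
      y<x+1 = ℚ.≤-<-trans (proj₁ (proj₁ (proj₂ placed (∈-ends y∈xs false))) (All.lookup xs≤x y∈xs)) (p<p+1 q)

    new-old : ∀ {y} → y ∈ xs → ∀ b b′ → Agrees _⊑_ (x , b) (y , b′) (point (λ _ → q) (x , b)) (point L (y , b′))
    new-old y∈xs false b′ = proj₂ (proj₂ placed (∈-ends y∈xs b′))
    new-old y∈xs true true =
      let ≤-case , <-case = proj₂ (proj₂ placed (∈-ends y∈xs false))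
      in (λ r → ℚ.+-monoˡ-≤ 1ℚ (≤-case (unshift r))) , (λ r → ℚ.+-monoˡ-< 1ℚ (<-case (r ∘ shift)))
    -- As `y` starts no later than `x`, `proper` leaves only one order between the right end of `x`
    -- and the left end of `y`.
    new-old {y} y∈xs true false =
        (λ x1⊑y → contradiction (⊑-trans x1⊑y y⊑x) proper)
      , (λ y⋢x1 → contradiction (⊑-trans y⊑x (⊑-total proper)) y⋢x1)
      where y⊑x = All.lookup xs≤x y∈xs

    new-new : ∀ b b′ → Agrees _⊑_ (x , b) (x , b′) (point (λ _ → q) (x , b)) (point (λ _ → q) (x , b′))
    new-new false false = (λ _ → ℚ.≤-refl) , contradiction ⊑-refl
    new-new true  true  = (λ _ → ℚ.≤-refl) , contradiction ⊑-refl
    new-new false true  = (λ _ → ℚ.<⇒≤ (p<p+1 q)) , (λ _ → p<p+1 q)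
    new-new true  false = (λ r → contradiction r proper) , contradiction (⊑-total proper)

    point-cong : ∀ {K M : Fin n → ℚ} {y} b → K y ≡ M y → point K (y , b) ≡ point M (y , b)
    point-cong false eq = eq
    point-cong true  eq = cong (_+ 1ℚ) eq

    at-new : ∀ b → point (λ _ → q) (x , b) ≡ point L′ (x , b)
    at-new b = sym (point-cong b L′-new)

    at-old : ∀ {y} → y ∈ xs → ∀ b → point L (y , b) ≡ point L′ (y , b)
    at-old y∈xs b = sym (point-cong b (L′-old y∈xs))

    faithful′ : Faithful L′ (x ∷ xs)
    faithful′ (here refl)  (here refl)  b b′ = subst₂ (Agrees _⊑_ _ _) (at-new b) (at-new b′) (new-new b b′)
    faithful′ (here refl)  (there z∈xs) b b′ = subst₂ (Agrees _⊑_ _ _) (at-new b) (at-old z∈xs b′) (new-old z∈xs b b′)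
    faithful′ (there y∈xs) (here refl)  b b′ = subst₂ (Agrees _⊑_ _ _) (at-old y∈xs b) (at-new b′) (old-new y∈xs b b′)
    faithful′ (there y∈xs) (there z∈xs) b b′ =
      subst₂ (Agrees _⊑_ _ _) (at-old y∈xs b) (at-old z∈xs b′) (faithful y∈xs z∈xs b b′)

  -- Ties count as equality, so antisymmetry holds by definition and the total preorder can be
  -- sorted.
  descending : DecTotalOrder _ _ _
  descending = record
    { Carrier = Fin n
    ; _≈_ = λ x y → (y , false) ⊑ (x , false) × (x , false) ⊑ (y , false)
    ; _≤_ = λ x y → (y , false) ⊑ (x , false)
    ; isDecTotalOrder = record
      { isTotalOrder = record
        { isPartialOrder = record
          { isPreorder = record
            { isEquivalence = record
              { refl = ⊑-refl , ⊑-refl ; sym = swap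
              ; trans = λ (p , q) (p′ , q′) → ⊑-trans p′ p , ⊑-trans q q′ }
            ; reflexive = proj₁
            ; trans = λ p q → ⊑-trans q p }
          ; antisym = _,_ }
        ; total = total }
      ; _≟_ = λ x y → ((y , false) ⊑? (x , false)) ×-dec ((x , false) ⊑? (y , false))
      ; _≤?_ = λ x y → (y , false) ⊑? (x , false) } }
    where
    total : ∀ x y → (y , false) ⊑ (x , false) ⊎ (x , false) ⊑ (y , false)
    total x y with (y , false) ⊑? (x , false)
    ... | yes y⊑x = inj₁ y⊑x
    ... | no  y⋢x = inj₂ (⊑-total y⋢x)

  representation : ∃ λ L → ∀ p r → Agrees _⊑_ p r (point L p) (point L r)
  representation with place (sort descending (allFin n))
    (Linked⇒AllPairs (λ p q → ⊑-trans q p) (sort-↗ descending (allFin n)))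
  ... | L , faithful = L , λ (x , b) (y , b′) → faithful (∈-sorted x) (∈-sorted y) b b′
    where
    ∈-sorted : ∀ x → x ∈ sort descending (allFin n)
    ∈-sorted x = ∈-resp-↭ (↭-sym (sort-↭ descending (allFin n))) (∈-allFin x)

-- Building a unit OC representation

-- Intervals that touch are comparable unless both are closed.
record UnitOC {n} (_≺_ : Fin n → Fin n → Set) : Set where
  field
    start  : Fin n → ℚ
    shut   : Fin n → Bool
    len    : ℚ
    before : ∀ x y → x ≺ y ⇔
      (start x + len ≤ start y × (shut x ≡ true → shut y ≡ true → start x + len < start y))

module Construction {n} {_≺_ : Fin n → Fin n → Set} (F : ForbiddenFree _≺_) where
  open Middles F
  private module Co = Middles (flip-free F)

  ⊏-flip : ∀ {b x} → b ⊏ x → b Co.⊏ x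
  ⊏-flip (a , c , a≺b , b≺c , a⊀x , x⊀c) = c , a , b≺c , a≺b , x⊀c , a⊀x

  ⊏-unflip : ∀ {b x} → b Co.⊏ x → b ⊏ x
  ⊏-unflip (c , a , b≺c , a≺b , x⊀c , a⊀x) = a , c , a≺b , b≺c , a⊀x , x⊀c

  ≼-flip : ∀ {x y} → x ≼ y → y Co.≼ x
  ≼-flip (p , s) = s , p

  ≼-unflip : ∀ {x y} → x Co.≼ y → y ≼ x
  ≼-unflip (s , p) = p , s

  ⊴-flip : ∀ {x y} → x ⊴ y → y Co.⊴ x
  ⊴-flip (inj₁ x≺y)                    = inj₁ x≺y
  ⊴-flip (inj₂ (inj₁ (u , u⊏x , u≺y))) = inj₂ (inj₂ (u , ⊏-flip u⊏x , u≺y))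
  ⊴-flip (inj₂ (inj₂ (v , v⊏y , x≺v))) = inj₂ (inj₁ (v , ⊏-flip v⊏y , x≺v))

  ⊴-unflip : ∀ {x y} → x Co.⊴ y → y ⊴ x
  ⊴-unflip (inj₁ y≺x)                    = inj₁ y≺x
  ⊴-unflip (inj₂ (inj₁ (u , u⊏x , y≺u))) = inj₂ (inj₂ (u , ⊏-unflip u⊏x , y≺u))
  ⊴-unflip (inj₂ (inj₂ (v , v⊏y , v≺x))) = inj₂ (inj₁ (v , ⊏-unflip v⊏y , v≺x))

  ⊴-strictʳ : ∀ {x y t} → y ≼ t → ¬ t ≼ y → x ⊴ y → x ≺ t
  ⊴-strictʳ y≼t t⋠y x⊴y = Co.⊴-strictˡ (≼-flip y≼t) (t⋠y ∘ ≼-unflip) (⊴-flip x⊴y)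

  ⊴-monoʳ : ∀ {x y t} → y ≼ t → x ⊴ y → x ⊴ t
  ⊴-monoʳ y≼t x⊴y = ⊴-unflip (Co.⊴-monoˡ (≼-flip y≼t) (⊴-flip x⊴y))

  touchˡ : ∀ {u x v y} → u ⊏ x → x ≺ v → v ⊏ y → u ≺ y
  touchˡ u⊏x x≺v v⊏y = Co.touchʳ (⊏-flip v⊏y) x≺v (⊏-flip u⊏x)

  middles-succ : ∀ {b b′ x z} → b ⊏ x → b′ ⊏ x → b ≺ z → b′ ≺ z
  middles-succ b⊏x b′⊏x = Co.middles-pred (⊏-flip b⊏x) (⊏-flip b′⊏x)

  _⊏?_ : Decidable _⊏_
  b ⊏? x = any? λ a → any? λ c → a ≺? b ×-dec b ≺? c ×-dec ¬? (a ≺? x) ×-dec ¬? (x ≺? c)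

  _⊴?_ : Decidable _⊴_
  x ⊴? y = x ≺? y ⊎-dec any? (λ u → u ⊏? x ×-dec u ≺? y) ⊎-dec any? (λ v → v ⊏? y ×-dec x ≺? v)

  Outer : Fin n → Set
  Outer x = ∀ {w} → ¬ x ⊏ w

  -- The indices are the host and the closedness flag, so matching on a role fixes both at once.
  data Role (b : Fin n) : Fin n → Bool → Set where
    outer  : Outer b → Role b b true
    middle : ∀ {x} → b ⊏ x → Role b x false

  -- The host of an element is a closed element with the same endpoints.
  role : ∀ b → ∃ λ x → ∃ (Role b x)
  role b with any? (b ⊏?_)
  ... | yes (x , b⊏x) = x , false , middle b⊏x
  ... | no  ¬middle   = b , true , outer λ b⊏w → ¬middle (_ , b⊏w)

  host : Fin n → Fin n
  host b = proj₁ (role b)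

  shut : Fin n → Bool
  shut b = proj₁ (proj₂ (role b))

  is : ∀ b → Role b (host b) (shut b)
  is b = proj₂ (proj₂ (role b))

  host-outer : ∀ {b x c} → Role b x c → Outer x
  host-outer (outer o)    = o
  host-outer (middle b⊏x) = container-not-middle b⊏x

  ≺⇒host-⊴ : ∀ {u v x y c d} → Role u x c → Role v y d → u ≺ v → x ⊴ y
  ≺⇒host-⊴ (outer _)    (outer _)    u≺v = inj₁ u≺v
  ≺⇒host-⊴ (outer _)    (middle v⊏y) u≺v = inj₂ (inj₂ (_ , v⊏y , u≺v))
  ≺⇒host-⊴ (middle u⊏x) (outer _)    u≺v = inj₂ (inj₁ (_ , u⊏x , u≺v))
  ≺⇒host-⊴ (middle u⊏x) (middle v⊏y) u≺v with middles-touch u⊏x v⊏y u≺v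
  ... | inj₁ x≺v = inj₂ (inj₂ (_ , v⊏y , x≺v))
  ... | inj₂ u≺y = inj₂ (inj₁ (_ , u⊏x , u≺y))

  ≺⇒host-≺ : ∀ {u v x y c d} → Role u x c → Role v y d → c ≡ true → d ≡ true → u ≺ v → x ≺ y
  ≺⇒host-≺ (outer _) (outer _) _ _ u≺v = u≺v

  host-≺⇒≺ : ∀ {u v x y c d} → Role u x c → Role v y d → x ≺ y → u ≺ v
  host-≺⇒≺ (outer _)    (outer _)    x≺y = x≺y
  host-≺⇒≺ (outer _)    (middle v⊏y) x≺y = ⊏-pred v⊏y x≺y
  host-≺⇒≺ (middle u⊏x) (outer _)    x≺y = ⊏-succ u⊏x x≺y
  host-≺⇒≺ (middle u⊏x) (middle v⊏y) x≺y = ⊏-pred v⊏y (⊏-succ u⊏x x≺y)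

  -- The middle witnessing the contact may differ from `u` or `v`. It can be exchanged because
  -- middles of one host have the same predecessors and successors, or carried to the other side by
  -- `touchʳ` and `touchˡ`.
  host-⊴⇒≺ : ∀ {u v x y c d} → Role u x c → Role v y d →
    (c ≡ true → d ≡ true → x ≺ y) → x ⊴ y → u ≺ v
  host-⊴⇒≺ (outer _) (outer _) shut-case _ = shut-case refl refl
  host-⊴⇒≺ ru rv _ (inj₁ x≺y) = host-≺⇒≺ ru rv x≺y
  host-⊴⇒≺ (outer _) (middle v⊏y) _ (inj₂ (inj₁ (_ , u′⊏x , u′≺y))) = touchʳ u′⊏x u′≺y v⊏y
  host-⊴⇒≺ (outer _) (middle v⊏y) _ (inj₂ (inj₂ (_ , v′⊏y , x≺v′))) = middles-pred v′⊏y v⊏y x≺v′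
  host-⊴⇒≺ (middle u⊏x) (outer _) _ (inj₂ (inj₁ (_ , u′⊏x , u′≺y))) = middles-succ u′⊏x u⊏x u′≺y
  host-⊴⇒≺ (middle u⊏x) (outer _) _ (inj₂ (inj₂ (_ , v′⊏y , x≺v′))) = touchˡ u⊏x x≺v′ v′⊏y
  host-⊴⇒≺ (middle u⊏x) (middle v⊏y) _ (inj₂ (inj₁ (_ , u′⊏x , u′≺y))) =
    ⊏-pred v⊏y (middles-succ u′⊏x u⊏x u′≺y)
  host-⊴⇒≺ (middle u⊏x) (middle v⊏y) _ (inj₂ (inj₂ (_ , v′⊏y , x≺v′))) =
    ⊏-succ u⊏x (middles-pred v′⊏y v⊏y x≺v′)

  -- `false` is the left end and `true` the right end. Equal lengths make right ends compare like
  -- left ends; hosts are closed, so the left end of `x` is at most the right end of `y` unless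
  -- `y ≺ x`.
  EndpointOrder : Bool → Bool → Fin n → Fin n → Set
  EndpointOrder false false x y = x ≼ y
  EndpointOrder true  true  x y = x ≼ y
  EndpointOrder true  false x y = x ⊴ y
  EndpointOrder false true  x y = ¬ y ≺ x

  endpoint? : ∀ b b′ x y → Dec (EndpointOrder b b′ x y)
  endpoint? false false x y = x ≼? y
  endpoint? true  true  x y = x ≼? y
  endpoint? true  false x y = x ⊴? y
  endpoint? false true  x y = ¬? (y ≺? x)

  endpoint-trans : ∀ b₁ b₂ b₃ {x y z} → Outer x → Outer y → Outer z →
    EndpointOrder b₁ b₂ x y → EndpointOrder b₂ b₃ y z → EndpointOrder b₁ b₃ x z
  endpoint-trans false false false _ _ _ x≼y y≼z = ≼-trans x≼y y≼z
  endpoint-trans false false true  _ _ _ x≼y z⊀y = z⊀y ∘ proj₁ x≼y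
  -- If `z` started strictly before `x`, the end of `y`, at or before the start of `z`, would lie
  -- strictly before `x`.
  endpoint-trans false true  false {x} {y} {z} ox _ oz y⊀x y⊴z = decidable-stable (x ≼? z) λ x⋠z →
    y⊀x (⊴-strictʳ (⋠⇒≼ ox oz x⋠z) x⋠z y⊴z)
  endpoint-trans false true  true  _ _ _ y⊀x y≼z = y⊀x ∘ proj₂ y≼z
  endpoint-trans true  false false _ _ _ x⊴y y≼z = ⊴-monoʳ y≼z x⊴y
  endpoint-trans true  false true  {x} {y} {z} ox _ oz x⊴y z⊀y = decidable-stable (x ≼? z) λ x⋠z →
    z⊀y (⊴-strictˡ (⋠⇒≼ ox oz x⋠z) x⋠z x⊴y)
  endpoint-trans true  true  false _ _ _ x≼y y⊴z = ⊴-monoˡ x≼y y⊴z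
  endpoint-trans true  true  true  _ _ _ x≼y y≼z = ≼-trans x≼y y≼z

  endpoint-total : ∀ b b′ {x y} → Outer x → Outer y → ¬ EndpointOrder b b′ x y → EndpointOrder b′ b y x
  endpoint-total false false ox oy = ⋠⇒≼ ox oy
  endpoint-total true  true  ox oy = ⋠⇒≼ ox oy
  endpoint-total true  false _ _ x⋬y x≺y = x⋬y (inj₁ x≺y)
  endpoint-total false true  {x} {y} _ _ ¬y⊀x = inj₁ (decidable-stable (y ≺? x) ¬y⊀x)

  _⊑_ : Fin n × Bool → Fin n × Bool → Set
  (x , b) ⊑ (y , b′) = EndpointOrder b b′ (host x) (host y)

  _⊑?_ : Decidable _⊑_
  (x , b) ⊑? (y , b′) = endpoint? b b′ (host x) (host y)

  ⊑-trans : ∀ {p r s} → p ⊑ r → r ⊑ s → p ⊑ s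
  ⊑-trans {x , b₁} {y , b₂} {z , b₃} =
    endpoint-trans b₁ b₂ b₃ (host-outer (is x)) (host-outer (is y)) (host-outer (is z))

  ⊑-total : ∀ {p r} → ¬ p ⊑ r → r ⊑ p
  ⊑-total {x , b} {y , b′} = endpoint-total b b′ (host-outer (is x)) (host-outer (is y))

  representation : ∃ λ L → ∀ p r → Agrees _⊑_ p r (point L p) (point L r)
  -- Both shift conditions are `id` since `EndpointOrder` treats two right ends exactly as two left
  -- ends.
  representation = Placement.representation _⊑?_
    (λ {p} {r} {s} → ⊑-trans {p} {r} {s}) (λ {p} {r} → ⊑-total {p} {r}) id id ⊴-irrefl

  unitOC : UnitOC _≺_
  unitOC = record { start = L ; shut = shut ; len = 1ℚ ; before = λ x y → mk⇔ (forth x y) (back x y) }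
    where
    L = proj₁ representation
    agrees = proj₂ representation

    forth : ∀ x y → x ≺ y → L x + 1ℚ ≤ L y × (shut x ≡ true → shut y ≡ true → L x + 1ℚ < L y)
    forth x y x≺y = proj₁ (agrees (x , true) (y , false)) (≺⇒host-⊴ (is x) (is y) x≺y)
      , λ cx cy → proj₂ (agrees (x , true) (y , false)) λ hx⊀hy → hx⊀hy (≺⇒host-≺ (is x) (is y) cx cy x≺y)

    back : ∀ x y → L x + 1ℚ ≤ L y × (shut x ≡ true → shut y ≡ true → L x + 1ℚ < L y) → x ≺ y
    back x y (x≤y , strict) = host-⊴⇒≺ (is x) (is y) near far
      where
      far : host x ⊴ host y
      far = decidable-stable (host x ⊴? host y) λ x⋬y →
        ℚ.<-irrefl refl (ℚ.<-≤-trans (proj₂ (agrees (y , false) (x , true)) x⋬y) x≤y)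
      near : shut x ≡ true → shut y ≡ true → host x ≺ host y
      near cx cy = decidable-stable (host x ≺? host y) λ x⊀y →
        ℚ.<-irrefl refl (ℚ.<-≤-trans (strict cx cy) (proj₁ (agrees (y , false) (x , true)) x⊀y))

-- Precedence of OC intervals in terms of endpoints

<-⊓ : ∀ {p q r} → p < q → p < r → p < q ⊓ r
<-⊓ {p} {q} {r} p<q p<r with ℚ.⊓-sel q r
... | inj₁ eq = subst (p <_) (sym eq) p<q
... | inj₂ eq = subst (p <_) (sym eq) p<r

⊔-< : ∀ {p q r} → p < r → q < r → p ⊔ q < r
⊔-< {p} {q} {r} p<r q<r with ℚ.⊔-sel p q
... | inj₁ eq = subst (_< r) (sym eq) p<r
... | inj₂ eq = subst (_< r) (sym eq) q<r

interior : ∀ J {q} → left J < q → q < right J → q ∈I J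
interior (oc _ _ true)  l<q q<r = ℚ.<⇒≤ l<q , ℚ.<⇒≤ q<r
interior (oc _ _ false) l<q q<r = l<q , q<r

precedes⇔ : ∀ J K → left J < right J → left K < right K →
  Precedes J K ⇔ (right J ≤ left K × (closed J ≡ true → closed K ≡ true → right J < left K))
precedes⇔ J K lJ<rJ lK<rK = mk⇔ (λ J≺K → ℚ.≮⇒≥ (apart J≺K) , ends J K lJ<rJ lK<rK J≺K) (λ (le , lt) → far J K le lt)
  where
  apart : Precedes J K → ¬ left K < right J
  apart J≺K lK<rJ with ℚ.<-dense (<-⊓ lK<rK lK<rJ)
  -- If `K` started before the end of `J`, a point `q` of `K` could be chosen below both right ends,
  -- and then a point `p` of `J` beyond `q`, in the wrong order.
  ... | q , lK<q , q<m with ℚ.<-dense (⊔-< lJ<rJ (ℚ.<-≤-trans q<m (ℚ.p⊓q≤q (right K) (right J))))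
  ... | p , m<p , p<rJ = ℚ.<-asym q<p (J≺K p q
      (interior J (ℚ.≤-<-trans (ℚ.p≤p⊔q (left J) q) m<p) p<rJ)
      (interior K lK<q (ℚ.<-≤-trans q<m (ℚ.p⊓q≤p (right K) (right J)))))
    where
    q<p : q < p
    q<p = ℚ.≤-<-trans (ℚ.p≤q⊔p (left J) q) m<p

  ends : ∀ J K → left J < right J → left K < right K → Precedes J K →
    closed J ≡ true → closed K ≡ true → right J < left K
  ends (oc _ _ true) (oc _ _ true) lJ<rJ lK<rK J≺K _ _ =
    J≺K _ _ (ℚ.<⇒≤ lJ<rJ , ℚ.≤-refl) (ℚ.≤-refl , ℚ.<⇒≤ lK<rK)

  far : ∀ J K → right J ≤ left K → (closed J ≡ true → closed K ≡ true → right J < left K) → Precedes J K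
  far (oc _ _ true)  (oc _ _ true)  _  lt p q (_ , p≤r) (l≤q , _) = ℚ.<-≤-trans (ℚ.≤-<-trans p≤r (lt refl refl)) l≤q
  far (oc _ _ true)  (oc _ _ false) le _  p q (_ , p≤r) (l<q , _) = ℚ.≤-<-trans (ℚ.≤-trans p≤r le) l<q
  far (oc _ _ false) (oc _ _ true)  le _  p q (_ , p<r) (l≤q , _) = ℚ.<-≤-trans p<r (ℚ.≤-trans le l≤q)
  far (oc _ _ false) (oc _ _ false) le _  p q (_ , p<r) (l<q , _) = ℚ.<-trans (ℚ.<-≤-trans p<r le) l<q

-- Forbidden posets have no unit OC representation

module Induced Q {n} (_≺_ : Fin n → Fin n → Set) (Q-in : InducedIn Q _≺_) where
  at : Fin (size Q) → Fin n
  at = proj₁ Q-in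

  related : ∀ i j {_ : True (srel? Q i j)} → at i ≺ at j
  related i j {i~j} = to (proj₂ (proj₂ Q-in) i j) (toWitness i~j)

  unrel : ∀ i j {_ : False (srel? Q i j)} → ¬ at i ≺ at j
  unrel i j {i≁j} = toWitnessFalse i≁j ∘ from (proj₂ (proj₂ Q-in) i j)

module Representation {n} {_≺_ : Fin n → Fin n → Set} (U : UnitOC _≺_) where
  open UnitOC U

  ≺⇒≤ : ∀ {x y} → x ≺ y → start x + len ≤ start y
  ≺⇒≤ {x} {y} x≺y = proj₁ (to (before x y) x≺y)

  ⊀⇒≥ : ∀ {x y} → ¬ x ≺ y → start y ≤ start x + len
  ⊀⇒≥ {x} {y} x⊀y = ℚ.≮⇒≥ λ lt → x⊀y (from (before x y) (ℚ.<⇒≤ lt , λ _ _ → lt))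

  touching : ∀ {x y} → ¬ x ≺ y → start x + len ≤ start y → shut x ≡ true × shut y ≡ true
  touching {x} {y} x⊀y le = by-cases _ _ refl refl
    where
    by-cases : ∀ b b′ → shut x ≡ b → shut y ≡ b′ → shut x ≡ true × shut y ≡ true
    by-cases true  true  bx by = bx , by
    by-cases false _     bx _  = contradiction (from (before x y) (le , λ tx _ → contradiction (≡.trans (sym tx) bx) λ ())) x⊀y
    by-cases true  false _  by = contradiction (from (before x y) (le , λ _ ty → contradiction (≡.trans (sym ty) by) λ ())) x⊀y

  record Rigid (a b c x : Fin n) : Set where
    field
      left-shut   : shut a ≡ true
      right-shut  : shut c ≡ true
      middle-open : shut b ≡ false
      middle-at   : start b ≡ start x
      right-at    : start c ≡ start x + len

  -- The start of `b` is squeezed: `a` forces it to be at least that of `x`, and `c` at most. Hence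
  -- `a` touches `x` and `x` touches `c` without comparability, so all three are closed; `a` also
  -- touches `b` but precedes it, so `b` is open.
  rigid : ∀ {a b c x} → a ≺ b → b ≺ c → ¬ a ≺ x → ¬ x ≺ c → Rigid a b c x
  rigid {a} {b} {c} {x} a≺b b≺c a⊀x x⊀c = record
    { left-shut   = proj₁ a-x
    ; right-shut  = proj₂ (touching x⊀c x+≤c)
    ; middle-open = open′ (shut b) refl
    ; middle-at   = b≡x
    ; right-at    = ℚ.≤-antisym (⊀⇒≥ x⊀c) x+≤c
    }
    where
    b≤x : start b ≤ start x
    b≤x = ℚ.≮⇒≥ λ x<b → ℚ.<-irrefl refl
      (ℚ.<-≤-trans (ℚ.+-monoˡ-< len x<b) (ℚ.≤-trans (≺⇒≤ b≺c) (⊀⇒≥ x⊀c)))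
    b≡x : start b ≡ start x
    b≡x = ℚ.≤-antisym b≤x (ℚ.≤-trans (⊀⇒≥ a⊀x) (≺⇒≤ a≺b))
    a-x : shut a ≡ true × shut x ≡ true
    a-x = touching a⊀x (ℚ.≤-trans (≺⇒≤ a≺b) b≤x)
    x+≤c : start x + len ≤ start c
    x+≤c = subst (λ q → q + len ≤ start c) b≡x (≺⇒≤ b≺c)
    open′ : ∀ s → shut b ≡ s → shut b ≡ false
    open′ false b-open = b-open
    open′ true  b-shut = contradiction
      (ℚ.<-≤-trans (proj₂ (to (before a b) a≺b) (proj₁ a-x) b-shut) (ℚ.≤-trans b≤x (⊀⇒≥ a⊀x)))
      (ℚ.<-irrefl refl)
  open Rigid

  same-preds : ∀ {b c z} → start b ≡ start c → shut b ≡ shut c → z ≺ b → z ≺ c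
  same-preds {b} {c} {z} at-eq shut-eq z≺b = from (before z c)
    (subst₂ (λ q s → start z + len ≤ q × (shut z ≡ true → s ≡ true → start z + len < q)) at-eq shut-eq (to (before z b) z≺b))

  same-succs : ∀ {b c z} → start b ≡ start c → shut b ≡ shut c → b ≺ z → c ≺ z
  same-succs {b} {c} {z} at-eq shut-eq b≺z = from (before c z)
    (subst₂ (λ q s → q + len ≤ start z × (s ≡ true → shut z ≡ true → q + len < start z)) at-eq shut-eq (to (before b z) b≺z))

  not-open-and-shut : ∀ {b} → shut b ≡ true → ¬ shut b ≡ false
  not-open-and-shut b-shut b-open = contradiction (≡.trans (sym b-shut) b-open) λ ()

  -- With `x`, the element `b` is the middle of `a`, `b`, `c` and the first of `b`, `c`, `d`, hence
  -- both open and closed. In `Z` the same clash arises with containers `x` and `y`.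
  ¬4+1 : ¬ InducedIn P4+1 _≺_
  ¬4+1 Q-in = not-open-and-shut
    (left-shut (rigid (related (# 1) (# 2)) (related (# 2) (# 3)) (unrel (# 1) (# 4)) (unrel (# 4) (# 3))))
    (middle-open (rigid (related (# 0) (# 1)) (related (# 1) (# 2)) (unrel (# 0) (# 4)) (unrel (# 4) (# 2))))
    where open Induced P4+1 _≺_ Q-in

  -- Both `b` and `c` are open with the start of `x`, so `y` cannot distinguish them.
  ¬D* : ¬ InducedIn D* _≺_
  ¬D* Q-in = unrel (# 5) (# 1) (same-preds
    (≡.trans (middle-at c-rigid) (sym (middle-at b-rigid)))
    (≡.trans (middle-open c-rigid) (sym (middle-open b-rigid))) (related (# 5) (# 2)))
    where
    open Induced D* _≺_ Q-in
    b-rigid = rigid (related (# 0) (# 1)) (related (# 1) (# 3)) (unrel (# 0) (# 4)) (unrel (# 4) (# 3))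
    c-rigid = rigid (related (# 0) (# 2)) (related (# 2) (# 3)) (unrel (# 0) (# 4)) (unrel (# 4) (# 3))

  ¬Z : ¬ InducedIn Z _≺_
  ¬Z Q-in = not-open-and-shut
    (left-shut (rigid (related (# 1) (# 2)) (related (# 2) (# 3)) (unrel (# 1) (# 5)) (unrel (# 5) (# 3))))
    (middle-open (rigid (related (# 0) (# 1)) (related (# 1) (# 2)) (unrel (# 0) (# 4)) (unrel (# 4) (# 2))))
    where open Induced Z _≺_ Q-in

  -- Both `b` and `c` are closed and start where `x` ends, so they have the same successors; for
  -- `Y**`, the same predecessors.
  ¬Y* : ¬ InducedIn Y* _≺_
  ¬Y* Q-in = unrel (# 1) (# 5) (same-succs
    (≡.trans (right-at c-rigid) (sym (right-at b-rigid)))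
    (≡.trans (right-shut c-rigid) (sym (right-shut b-rigid))) (related (# 2) (# 5)))
    where
    open Induced Y* _≺_ Q-in
    b-rigid = rigid (related (# 0) (# 3)) (related (# 3) (# 1)) (unrel (# 0) (# 4)) (unrel (# 4) (# 1))
    c-rigid = rigid (related (# 0) (# 3)) (related (# 3) (# 2)) (unrel (# 0) (# 4)) (unrel (# 4) (# 2))

  ¬Y** : ¬ InducedIn Y** _≺_
  ¬Y** Q-in = unrel (# 5) (# 1) (same-preds
    (≡.trans (right-at c-rigid) (sym (right-at b-rigid)))
    (≡.trans (right-shut c-rigid) (sym (right-shut b-rigid))) (related (# 5) (# 2)))
    where
    open Induced Y** _≺_ Q-in
    b-rigid = rigid (related (# 0) (# 3)) (related (# 3) (# 1)) (unrel (# 0) (# 4)) (unrel (# 4) (# 1))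
    c-rigid = rigid (related (# 0) (# 3)) (related (# 3) (# 2)) (unrel (# 0) (# 4)) (unrel (# 4) (# 2))

  base-free : All (λ Q → ¬ InducedIn Q _≺_) forbiddenBase
  base-free = ¬4+1 ∷ ¬D* ∷ ¬Z ∷ ¬Y* ∷ ¬Y** ∷ []

-- Reflection, translation to OC intervals, and the two directions

-‿involutive : ∀ p → - - p ≡ p
-‿involutive = GroupProperties.⁻¹-involutive ℚ.+-0-group

cancel-len : ∀ p len → - (p + len) + len ≡ - p
cancel-len p len = begin
  - (p + len) + len       ≡⟨ cong (_+ len) (ℚ.neg-distrib-+ p len) ⟩
  - p + - len + len       ≡⟨ ℚ.+-assoc (- p) (- len) len ⟩
  - p + (- len + len)     ≡⟨ cong (- p +_) (ℚ.+-inverseˡ len) ⟩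
  - p + 0ℚ                ≡⟨ ℚ.+-identityʳ (- p) ⟩
  - p                     ∎
  where open ≡.≡-Reasoning

reflect-≤ : ∀ {p q} len → p + len ≤ q → - q + len ≤ - p
reflect-≤ {p} {q} len le = subst (- q + len ≤_) (cancel-len p len) (ℚ.+-monoˡ-≤ len (ℚ.neg-antimono-≤ le))

reflect-< : ∀ {p q} len → p + len < q → - q + len < - p
reflect-< {p} {q} len lt = subst (- q + len <_) (cancel-len p len) (ℚ.+-monoˡ-< len (ℚ.neg-antimono-< lt))

-- Reflection in the origin makes `- start x` a right endpoint; using it as a left endpoint instead
-- translates all intervals by `len`, which changes no comparison. This reduces the dual posets to
-- the base ones.
flip-unitOC : ∀ {n} {_≺_ : Fin n → Fin n → Set} → UnitOC _≺_ → UnitOC (flip _≺_)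
flip-unitOC {_≺_ = _≺_} U = record
  { start = -_ ∘ start ; shut = shut ; len = len ; before = λ x y → mk⇔ (forth x y) (back x y) }
  where
  open UnitOC U
  forth : ∀ x y → y ≺ x → - start x + len ≤ - start y ×
    (shut x ≡ true → shut y ≡ true → - start x + len < - start y)
  forth x y y≺x = let le , lt = to (before y x) y≺x
    in reflect-≤ len le , λ sx sy → reflect-< len (lt sy sx)

  back : ∀ x y → - start x + len ≤ - start y ×
    (shut x ≡ true → shut y ≡ true → - start x + len < - start y) → y ≺ x
  back x y (le , lt) = from (before y x)
    ( subst₂ (λ p q → p + len ≤ q) (-‿involutive (start y)) (-‿involutive (start x)) (reflect-≤ len le)
    , λ sy sx → subst₂ (λ p q → p + len < q) (-‿involutive (start y)) (-‿involutive (start x)) (reflect-< len (lt sx sy)))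

unitOC⇒isUnitOC : ∀ {n} {_≺_ : Fin n → Fin n → Set} (U : UnitOC _≺_) → 0ℚ < UnitOC.len U → IsUnitOCIntervalOrder _≺_
unitOC⇒isUnitOC {n} U 0<len = I , len , 0<len , (λ _ → refl) , λ x y →
  mk⇔ (from (char x y) ∘ to (before x y)) (from (before x y) ∘ to (char x y))
  where
  open UnitOC U
  I : Fin n → OCInterval
  I x = oc (start x) (start x + len) (shut x)
  char = λ x y → precedes⇔ (I x) (I y) (p<p+q 0<len) (p<p+q 0<len)

isUnitOC⇒unitOC : ∀ {n} {_≺_ : Fin n → Fin n → Set} → IsUnitOCIntervalOrder _≺_ → UnitOC _≺_
isUnitOC⇒unitOC {_≺_ = _≺_} (I , len , 0<len , right≡ , rep) = record
  { start = left ∘ I ; shut = closed ∘ I ; len = len ; before = before }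
  where
  left<right : ∀ x → left (I x) < right (I x)
  left<right x = subst (left (I x) <_) (sym (right≡ x)) (p<p+q 0<len)
  before : ∀ x y → x ≺ y ⇔ (left (I x) + len ≤ left (I y) ×
    (closed (I x) ≡ true → closed (I y) ≡ true → left (I x) + len < left (I y)))
  before x y = subst
    (λ r → x ≺ y ⇔ (r ≤ left (I y) × (closed (I x) ≡ true → closed (I y) ≡ true → r < left (I y))))
    (right≡ x) (mk⇔ (to char ∘ to (rep x y)) (from (rep x y) ∘ from char))
    where char = precedes⇔ (I x) (I y) (left<right x) (left<right y)

interval-order : ∀ {n} {_≺_ : Fin n → Fin n → Set} → Decidable _≺_ → IsIntervalOrder _≺_ → IntervalOrder _≺_
interval-order {_≺_ = _≺_} _≺?_ (L , R , L≤R , rep) = record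
  { _≺?_ = _≺?_
  ; irrefl = λ {x} x≺x → ℚ.<-irrefl refl (ℚ.<-≤-trans (to (rep x x) x≺x) (L≤R x))
  ; ferrers = λ {x} {y} {z} {w} x≺y z⊀y z≺w → from (rep x w)
      (ℚ.<-trans (ℚ.<-≤-trans (to (rep x y) x≺y) (ℚ.≮⇒≥ (z⊀y ∘ from (rep z y)))) (to (rep z w) z≺w))
  }

theorem17 : (n : ℕ) (_≺_ : Fin n → Fin n → Set)
    → IsStrictPartialOrder _≡_ _≺_ → Decidable _≺_
    → IsIntervalOrder _≺_
    → (IsUnitOCIntervalOrder _≺_ ⇔ All (λ Q → ¬ InducedIn Q _≺_) forbidden)
theorem17 n _≺_ _ _≺?_ interval = mk⇔ necessary sufficient
  where
  necessary : IsUnitOCIntervalOrder _≺_ → All (λ Q → ¬ InducedIn Q _≺_) forbidden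
  necessary rep = ++⁺ (Representation.base-free U)
    (map⁺ (All.map (λ {Q} ¬Q Q-in → ¬Q (InducedIn-dual⁻ Q _≺_ Q-in)) (Representation.base-free (flip-unitOC U))))
    where U = isUnitOC⇒unitOC rep

  sufficient : All (λ Q → ¬ InducedIn Q _≺_) forbidden → IsUnitOCIntervalOrder _≺_
  sufficient avoids = unitOC⇒isUnitOC (Construction.unitOC F) (ℚ.positive⁻¹ 1ℚ)
    where
    F : ForbiddenFree _≺_
    F = record
      { order  = interval-order _≺?_ interval
      ; free   = proj₁ (++⁻ forbiddenBase avoids)
      ; cofree = All.map (λ {Q} ¬Q → ¬Q ∘ InducedIn-dual⁺ Q _≺_) (map⁻ (proj₂ (++⁻ forbiddenBase avoids)))
      }
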